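{- Let $\pi = 1 \oplus \rho$ where $\rho$ ends with its smallest entry and its first entry $\rho(1)$ satisfies $\rho(1)\neq 2$ and $\rho(1)\neq|\rho|$; equivalently, $\pi$ has the form $1\,z\cdots 2$ with $z \neq 3$ and $z \neq |\pi|$. Then the class $\operatorname{Av}(\pi)$ is not deflatable.
   Context: A permutation $\alpha$ is contained in $\beta$ if $\beta$ has a subsequence in the same relative order as $\alpha$; a class is a set of permutations closed under taking contained permutations; $\operatorname{Av}(\pi)$ is the class of permutations not containing $\pi$. $1\oplus\rho$ denotes a new minimum entry placed before a copy of $\rho$. An interval of a permutation is a set of entries whose positions and values each form a set of consecutive integers, the whole permutation not counting as an interval; a permutation is simple if all its intervals are single entries (so $1$, $12$, $21$ are simple). A class $\mathcal{C}$ is deflatable if there is a proper subclass $\mathcal{D}\subsetneq\mathcal{C}$ with $\mathcal{C}\subseteq\langle\mathcal{D}\rangle$, where the substitution closure $\langle\mathcal{D}\rangle$ is the largest class whose simple permutations are exactly those of $\mathcal{D}$; equivalently, $\mathcal{C}$ is not deflatable if and only if every permutation in $\mathcal{C}$ is contained in some simple permutation belonging to $\mathcal{C}$. -}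

module Defs where

open import Data.Nat using (ℕ; zero; suc; _+_; _∸_; _≤_)
open import Data.Fin using (Fin; zero; suc; toℕ; _<_) renaming (_≤_ to _≤ᶠ_)
open import Data.Fin.Properties using (suc-injective)
open import Data.Product using (Σ; ∃; _×_; _,_)
open import Relation.Binary.PropositionalEquality using (_≡_; refl; cong)
open import Relation.Nullary using (¬_)
open import Function.Definitions using (Injective)

-- A permutation of length len, as an injective (hence bijective) map
-- from positions {0..len-1} to values {0..len-1} (0-indexed).
record Perm : Set where
  constructor perm
  field
    len : ℕ
    fun : Fin len → Fin len
    inj : Injective _≡_ _≡_ fun
open Perm public

_≼_ : Perm → Perm → Set
α ≼ β = Σ (Fin (len α) → Fin (len β)) λ f →
          (∀ i j → i < j → f i < f j) ×
          (∀ i j → (fun α i < fun α j → fun β (f i) < fun β (f j)) ×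
                   (fun β (f i) < fun β (f j) → fun α i < fun α j))

IsClass : (Perm → Set) → Set
IsClass C = ∀ σ τ → τ ≼ σ → C σ → C τ

Av : Perm → Perm → Set
Av π σ = ¬ (π ≼ σ)

IsInterval : (σ : Perm) → Fin (len σ) → Fin (len σ) → Set
IsInterval σ i j =
  (i ≤ᶠ j) ×
  ¬ (toℕ i ≡ 0 × suc (toℕ j) ≡ len σ) ×
  ∃ λ a →
    (∀ k → i ≤ᶠ k → k ≤ᶠ j →
       a ≤ toℕ (fun σ k) × toℕ (fun σ k) ≤ a + (toℕ j ∸ toℕ i)) ×
    (∀ v → a ≤ v → v ≤ a + (toℕ j ∸ toℕ i) →
       ∃ λ k → i ≤ᶠ k × k ≤ᶠ j × toℕ (fun σ k) ≡ v)

Simple : Perm → Set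
Simple σ = ∀ i j → IsInterval σ i j → i ≡ j

-- Substitution closure ⟨D⟩: the largest class whose simple permutations
-- are those of D, i.e. the permutations all of whose simple subpermutations lie in D.
SubstClosure : (Perm → Set) → Perm → Set
SubstClosure D σ = ∀ τ → Simple τ → τ ≼ σ → D τ

Deflatable : (Perm → Set) → Set₁
Deflatable C = Σ (Perm → Set) λ D →
  IsClass D ×
  (∀ σ → D σ → C σ) ×
  ¬ (∀ σ → C σ → D σ) ×
  (∀ σ → C σ → SubstClosure D σ)

oneSumFun : {n : ℕ} → (Fin n → Fin n) → Fin (suc n) → Fin (suc n)
oneSumFun f zero = zero
oneSumFun f (suc i) = suc (f i)

oneSumInj : {n : ℕ} (f : Fin n → Fin n) → Injective _≡_ _≡_ f →
            Injective _≡_ _≡_ (oneSumFun f)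
oneSumInj f inj {zero} {zero} e = refl
oneSumInj f inj {zero} {suc j} ()
oneSumInj f inj {suc i} {zero} ()
oneSumInj f inj {suc i} {suc j} e = cong suc (inj (suc-injective e))

1⊕_ : Perm → Perm
1⊕ ρ = perm (suc (len ρ)) (oneSumFun (fun ρ)) (oneSumInj (fun ρ) (inj ρ))

{-# OPTIONS --safe #-}

-- It suffices to embed every σ avoiding π in a simple permutation that avoids π.
-- Surround every value v of σ by three new points, so that the four of them, called
-- floor, orig, link, cap, have the consecutive values 4v, 4v+1, 4v+2, 4v+3.
-- Let ℓ be the position of the first entry of σ that is at most v.  The floor and then
-- the cap are put just before ℓ (blocks of larger v first), and the link just before
-- the last orig or cap that precedes that floor.
-- Simplicity: two points of an interval force a whole block into it, and links tie
-- every block to its neighbours.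
-- Avoidance: floors and links are left-to-right minima, so they can only play the 1 of
-- π.  A cap has only its own floor, its own link and possibly the link of the block below to
-- its lower left; if it is used in an occurrence of π it plays z, and then z = 3, or
-- it plays 2, and then there is no room for the rest of π.  Hence all entries except
-- the 1 are in σ, and the 1 can be replaced by an entry of σ.
module Submission where

open import Defs
open import Data.Nat using (ℕ; zero; suc; _+_; _*_; _∸_; z≤n; s≤s)
import Data.Nat as ℕ
import Data.Nat.Properties as ℕ
open import Data.Fin using (Fin; zero; suc; toℕ; fromℕ; fromℕ<; _<_; punchOut; splitAt; _↑ˡ_; _↑ʳ_; combine; remQuot) renaming (_≤_ to _≤ᶠ_)
open import Data.Fin.Patterns using (0F; 1F; 2F; 3F)
open import Data.Fin.Properties using (toℕ-injective; toℕ-fromℕ; toℕ-fromℕ<; toℕ<n; toℕ≤pred[n]; any?; _≟_; <-cmp; <⇒notInjective; punchOut-injective; splitAt-↑ˡ; splitAt-↑ʳ; splitAt⁻¹-↑ˡ; splitAt⁻¹-↑ʳ; remQuot-combine; combine-remQuot; toℕ-combine; combine-monoˡ-<)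
open import Data.Fin.Subset using (Subset; _∈_; ∣_∣; ⊤)
open import Data.Fin.Subset.Properties using (p⊂q⇒∣p∣<∣q∣; ∣⊤∣≡n; ∈⊤)
open import Data.Vec using (tabulate)
open import Data.Vec.Properties using (lookup∘tabulate; lookup⇒[]=; []=⇒lookup)
open import Data.Bool using (true)
open import Data.Product using (∃; _×_; _,_; proj₁; proj₂; uncurry)
open import Data.Sum using (_⊎_; inj₁; inj₂; [_,_])
open import Data.Empty using (⊥)
open import Function using (_∘_; id)
open import Function.Definitions using (Injective)
open import Relation.Binary using (tri<; tri≈; tri>)
open import Relation.Binary.PropositionalEquality using (_≡_; _≢_; refl; sym; trans; cong; subst; subst₂)
open import Relation.Nullary using (¬_; Dec; yes; no; does; contradiction)
open import Relation.Nullary.Decidable using (dec-true)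

-- Reduction to covering by simple permutations.

≼-refl : ∀ σ → σ ≼ σ
≼-refl σ = id , (λ _ _ → id) , λ _ _ → id , id

-- A simple `τ` in `C` is a simple subpermutation of itself, so `C ⊆ ⟨D⟩` puts it in `D`. Being a
-- class, `D` then contains every `σ` below such a `τ`, hence all of `C`.
simpleCovers⇒¬Deflatable : ∀ {C} → (∀ σ → C σ → ∃ λ τ → Simple τ × C τ × σ ≼ τ) → ¬ Deflatable C
simpleCovers⇒¬Deflatable cover (D , D-class , _ , proper , C⊆⟨D⟩) = proper λ σ σ∈C →
  let τ , τ-simple , τ∈C , σ≼τ = cover σ σ∈C
  in D-class τ σ σ≼τ (C⊆⟨D⟩ τ τ∈C τ τ-simple (≼-refl τ))

-- Finite injections, ranks and two-digit keys.

injective⇒preimage : ∀ {n} {f : Fin n → Fin n} → Injective _≡_ _≡_ f → ∀ y → ∃ λ x → f x ≡ y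
injective⇒preimage {suc n} {f} f-inj y with any? (λ x → f x ≟ y)
... | yes found = found
... | no missed = contradiction
  (λ {i} {j} eq → f-inj (punchOut-injective (λ e → missed (i , sym e)) (λ e → missed (j , sym e)) eq))
  (<⇒notInjective {f = λ i → punchOut {i = y} {f i} (λ e → missed (i , sym e))} (ℕ.n<1+n n))

strictMono⇒injective : ∀ {m n} {f : Fin m → ℕ} {g : Fin m → Fin n} → Injective _≡_ _≡_ f →
  (∀ {x y} → f x ℕ.< f y → g x < g y) → Injective _≡_ _≡_ g
strictMono⇒injective {f = f} f-inj mono {x} {y} eq with ℕ.<-cmp (f x) (f y)
... | tri< lt _ _ = contradiction (cong toℕ eq) (ℕ.<⇒≢ (mono lt))
... | tri≈ _ e _  = f-inj e
... | tri> _ _ gt = contradiction (cong toℕ (sym eq)) (ℕ.<⇒≢ (mono gt))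

strictMono⇒reflects : ∀ {m n} {f : Fin m → ℕ} {g : Fin m → Fin n} → Injective _≡_ _≡_ f →
  (∀ {x y} → f x ℕ.< f y → g x < g y) → ∀ {x y} → g x < g y → f x ℕ.< f y
strictMono⇒reflects {f = f} f-inj mono {x} {y} lt with ℕ.<-cmp (f x) (f y)
... | tri< r _ _ = r
... | tri≈ _ e _ = contradiction lt (ℕ.<-irrefl (cong toℕ (cong _ (f-inj e))))
... | tri> _ _ r = contradiction lt (ℕ.<-asym (mono r))

does⇒ : {P : Set} (P? : Dec P) → does P? ≡ true → P
does⇒ (yes p) _ = p

-- Compresses keys with gaps to consecutive ranks, so a permutation can be specified by arithmetic
-- on keys.
module Rank {n} (key : Fin n → ℕ) where

  below : Fin n → Subset n
  below x = tabulate λ y → does (key y ℕ.<? key x)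

  ∈-below : ∀ {x y} → key y ℕ.< key x → y ∈ below x
  ∈-below {x} {y} lt = lookup⇒[]= y (below x)
    (trans (lookup∘tabulate _ y) (dec-true (key y ℕ.<? key x) lt))

  below-∈ : ∀ {x y} → y ∈ below x → key y ℕ.< key x
  below-∈ {x} {y} y∈ = does⇒ (key y ℕ.<? key x)
    (trans (sym (lookup∘tabulate (λ z → does (key z ℕ.<? key x)) y)) ([]=⇒lookup y∈))

  ∣below∣<n : ∀ x → ∣ below x ∣ ℕ.< n
  ∣below∣<n x = subst (∣ below x ∣ ℕ.<_) (∣⊤∣≡n n)
    (p⊂q⇒∣p∣<∣q∣ ((λ _ → ∈⊤) , x , ∈⊤ , ℕ.<-irrefl refl ∘ below-∈))

  rank : Fin n → Fin n
  rank x = fromℕ< (∣below∣<n x)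

  rank-mono : ∀ {x y} → key x ℕ.< key y → rank x < rank y
  rank-mono {x} {y} lt = subst₂ ℕ._<_ (sym (toℕ-fromℕ< (∣below∣<n x))) (sym (toℕ-fromℕ< (∣below∣<n y)))
    (p⊂q⇒∣p∣<∣q∣ ((λ z∈ → ∈-below (ℕ.<-trans (below-∈ z∈) lt)) , x , ∈-below lt , ℕ.<-irrefl refl ∘ below-∈))

leastElement : ∀ {n} {P : Fin n → Set} → (∀ x → Dec (P x)) → ∃ P → ∃ λ x → P x × (∀ y → P y → x ≤ᶠ y)
leastElement {suc n} P? (w , Pw) with P? zero
... | yes P0 = zero , P0 , λ _ _ → z≤n
leastElement {suc n} P? (zero , Pw) | no ¬P0 = contradiction Pw ¬P0
leastElement {suc n} P? (suc w , Pw) | no ¬P0 with leastElement (P? ∘ suc) (w , Pw)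
... | x , Px , least = suc x , Px , λ { zero P0 → contradiction P0 ¬P0 ; (suc y) Py → s≤s (least y Py) }

lex-< : ∀ K {a b c d} → a ℕ.< c → b ℕ.< K → b + a * K ℕ.< d + c * K
lex-< K {a} {b} {c} {d} a<c b<K = begin-strict
  b + a * K <⟨ ℕ.+-monoˡ-< (a * K) b<K ⟩
  suc a * K ≤⟨ ℕ.*-monoˡ-≤ K a<c ⟩
  c * K     ≤⟨ ℕ.m≤n+m (c * K) d ⟩
  d + c * K ∎
  where open ℕ.≤-Reasoning

lex-injective : ∀ K a c {b d} → b ℕ.< K → d ℕ.< K → b + a * K ≡ d + c * K → a ≡ c × b ≡ d
lex-injective K a c {b} {d} b<K d<K eq with ℕ.<-cmp a c
... | tri< a<c _ _ = contradiction eq (ℕ.<⇒≢ (lex-< K a<c b<K))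
... | tri≈ _ refl _ = refl , ℕ.+-cancelʳ-≡ (a * K) b d eq
... | tri> _ _ c<a = contradiction (sym eq) (ℕ.<⇒≢ (lex-< K c<a d<K))

-- Left-to-right order of the origs and caps.

-- A v and Q v are the ranks, among all origs and caps read from left to right,
-- of the orig and of the cap of block v.
record Slots (k : ℕ) : Set where
  field
    A Q         : Fin k → ℕ
    A-injective : ∀ {v w} → A v ≡ A w → v ≡ w
    A≢Q         : ∀ v w → A v ≢ Q w
    Q<A         : ∀ v → Q v ℕ.< A v
    Q-antitone  : ∀ {v w} → w < v → Q v ℕ.< Q w
    gapless     : ∀ v n → Q v ≡ suc n → ∃ λ w → A w ≡ n ⊎ Q w ≡ n
    leader      : ∀ v → ∃ λ p → p ≤ᶠ v × (∀ w → Q v ℕ.< A w → A p ℕ.≤ A w)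

module Positions (σ : Perm) where

  private
    k = len σ

  pos : Fin k → Fin k
  pos v = proj₁ (injective⇒preimage (inj σ) v)

  fun-pos : ∀ v → fun σ (pos v) ≡ v
  fun-pos v = proj₂ (injective⇒preimage (inj σ) v)

  pos-fun : ∀ i → pos (fun σ i) ≡ i
  pos-fun i = inj σ (fun-pos (fun σ i))

  pos-injective : ∀ {v w} → pos v ≡ pos w → v ≡ w
  pos-injective {v} {w} eq = trans (sym (fun-pos v)) (trans (cong (fun σ) eq) (fun-pos w))

  firstBelow : ∀ v → ∃ λ i → fun σ i ≤ᶠ v × (∀ j → fun σ j ≤ᶠ v → i ≤ᶠ j)
  firstBelow v = leastElement (λ i → toℕ (fun σ i) ℕ.≤? toℕ v) (pos v , ℕ.≤-reflexive (cong toℕ (fun-pos v)))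

  ℓ : Fin k → Fin k
  ℓ v = proj₁ (firstBelow v)

  ℓ-below : ∀ v → fun σ (ℓ v) ≤ᶠ v
  ℓ-below v = proj₁ (proj₂ (firstBelow v))

  ℓ-least : ∀ v w → w ≤ᶠ v → ℓ v ≤ᶠ pos w
  ℓ-least v w w≤v = proj₂ (proj₂ (firstBelow v)) (pos w) (subst (_≤ᶠ v) (sym (fun-pos w)) w≤v)

  ℓ-antitone : ∀ {v w} → w ≤ᶠ v → ℓ v ≤ᶠ ℓ w
  ℓ-antitone {v} {w} w≤v = proj₂ (proj₂ (firstBelow v)) (ℓ w) (ℕ.≤-trans (ℓ-below w) w≤v)

  -- Two-digit numbers in base `suc k`. The high digit is a position of σ. The low digit breaks
  -- ties: caps have digits below `k`, smaller for larger `v`, so they precede the orig at that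
  -- position, with higher blocks first.
  aKey qKey : Fin k → ℕ
  aKey v = k + toℕ (pos v) * suc k
  qKey v = k ∸ suc (toℕ v) + toℕ (ℓ v) * suc k

  key : Fin (k + k) → ℕ
  key = [ aKey , qKey ] ∘ splitAt k

  k∸<k : ∀ (v : Fin k) → k ∸ suc (toℕ v) ℕ.< k
  k∸<k v = ℕ.∸-monoʳ-< {k} {suc (toℕ v)} {0} (s≤s z≤n) (toℕ<n v)

  k∸<1+k : ∀ (v : Fin k) → k ∸ suc (toℕ v) ℕ.< suc k
  k∸<1+k v = ℕ.m<n⇒m<1+n (k∸<k v)

  aKey≢qKey : ∀ v w → aKey v ≢ qKey w
  aKey≢qKey v w eq = ℕ.<⇒≢ (k∸<k w) (sym (proj₂ (lex-injective (suc k) (toℕ (pos v)) (toℕ (ℓ w)) (ℕ.n<1+n k) (k∸<1+k w) eq)))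

  aKey-injective : ∀ {v w} → aKey v ≡ aKey w → v ≡ w
  aKey-injective {v} {w} eq = pos-injective (toℕ-injective (proj₁ (lex-injective (suc k) (toℕ (pos v)) (toℕ (pos w)) (ℕ.n<1+n k) (ℕ.n<1+n k) eq)))

  qKey-injective : ∀ {v w} → qKey v ≡ qKey w → v ≡ w
  qKey-injective {v} {w} eq = toℕ-injective (ℕ.suc-injective (ℕ.∸-cancelˡ-≡ (toℕ<n v) (toℕ<n w)
    (proj₂ (lex-injective (suc k) (toℕ (ℓ v)) (toℕ (ℓ w)) (k∸<1+k v) (k∸<1+k w) eq))))

  key-injective : Injective _≡_ _≡_ key
  key-injective {x} {y} eq with splitAt k x in ex | splitAt k y in ey
  ... | inj₁ v | inj₁ w = trans (sym (splitAt⁻¹-↑ˡ ex)) (trans (cong (_↑ˡ k) (aKey-injective eq)) (splitAt⁻¹-↑ˡ ey))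
  ... | inj₁ v | inj₂ w = contradiction eq (aKey≢qKey v w)
  ... | inj₂ v | inj₁ w = contradiction (sym eq) (aKey≢qKey w v)
  ... | inj₂ v | inj₂ w = trans (sym (splitAt⁻¹-↑ʳ ex)) (trans (cong (k ↑ʳ_) (qKey-injective eq)) (splitAt⁻¹-↑ʳ ey))

  open Rank key using (rank; rank-mono)

  rank-injective : Injective _≡_ _≡_ rank
  rank-injective = strictMono⇒injective key-injective rank-mono

  A Q : Fin k → ℕ
  A v = toℕ (rank (v ↑ˡ k))
  Q v = toℕ (rank (k ↑ʳ v))

  key-a : ∀ v → key (v ↑ˡ k) ≡ aKey v
  key-a v = cong [ aKey , qKey ] (splitAt-↑ˡ k v k)

  key-q : ∀ v → key (k ↑ʳ v) ≡ qKey v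
  key-q v = cong [ aKey , qKey ] (splitAt-↑ʳ k k v)

  A-mono : ∀ {v w} → pos v < pos w → A v ℕ.< A w
  A-mono {v} {w} lt = rank-mono (subst₂ ℕ._<_ (sym (key-a v)) (sym (key-a w)) (lex-< (suc k) lt (ℕ.n<1+n k)))

  A-mono-≤ : ∀ {v w} → pos v ≤ᶠ pos w → A v ℕ.≤ A w
  A-mono-≤ le with ℕ.m≤n⇒m<n∨m≡n le
  ... | inj₁ lt = ℕ.<⇒≤ (A-mono lt)
  ... | inj₂ eq = ℕ.≤-reflexive (cong A (pos-injective (toℕ-injective eq)))

  A-reflects : ∀ {v w} → A v ℕ.< A w → pos v < pos w
  A-reflects lt = ℕ.≰⇒> λ le → ℕ.<⇒≱ lt (A-mono-≤ le)

  Q<A-if : ∀ {v w} → ℓ v ≤ᶠ pos w → Q v ℕ.< A w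
  Q<A-if {v} {w} le = rank-mono (subst₂ ℕ._<_ (sym (key-q v)) (sym (key-a w))
    (ℕ.+-mono-<-≤ (k∸<k v) (ℕ.*-monoˡ-≤ (suc k) le)))

  A<Q-if : ∀ {v w} → pos w < ℓ v → A w ℕ.< Q v
  A<Q-if {v} {w} lt = rank-mono (subst₂ ℕ._<_ (sym (key-a w)) (sym (key-q v)) (lex-< (suc k) lt (ℕ.n<1+n k)))

  slots : Slots k
  slots = record
    { A = A
    ; Q = Q
    ; A-injective = λ {v} {w} eq → aKey-injective (trans (sym (key-a v))
        (trans (cong key (rank-injective (toℕ-injective eq))) (key-a w)))
    ; A≢Q = λ v w eq → aKey≢qKey v w (trans (sym (key-a v))
        (trans (cong key (rank-injective (toℕ-injective eq))) (key-q w)))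
    ; Q<A = λ v → Q<A-if (ℓ-least v v ℕ.≤-refl)
    -- `ℓ-antitone` alone allows ties; the low digit makes the comparison strict.
    ; Q-antitone = λ {v} {w} w<v → rank-mono (subst₂ ℕ._<_ (sym (key-q v)) (sym (key-q w))
        (ℕ.+-mono-<-≤ (ℕ.∸-monoʳ-< (s≤s w<v) (toℕ<n v)) (ℕ.*-monoˡ-≤ (suc k) (ℓ-antitone (ℕ.<⇒≤ w<v)))))
    ; gapless = gapless
    -- The leader is the entry at `ℓ v`: an entry further left has its orig before the cap of `v`.
    ; leader = λ v → fun σ (ℓ v) , ℓ-below v , λ w Qv<Aw →
        A-mono-≤ (subst (_≤ᶠ pos w) (sym (pos-fun (ℓ v))) (ℕ.≮⇒≥ λ lt → ℕ.<-asym Qv<Aw (A<Q-if lt)))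
    }
    where
    -- An injective `rank` on a finite set is onto, so the rank just below `Q v` is taken too, by an
    -- orig or by a cap.
    gapless : ∀ v n → Q v ≡ suc n → ∃ λ w → A w ≡ n ⊎ Q w ≡ n
    gapless v n Qv≡1+n = found (splitAt k x) refl
      where
      n<k+k : n ℕ.< k + k
      n<k+k = ℕ.<-trans (ℕ.n<1+n n) (subst (ℕ._< k + k) Qv≡1+n (toℕ<n (rank (k ↑ʳ v))))

      x : Fin (k + k)
      x = proj₁ (injective⇒preimage rank-injective (fromℕ< n<k+k))

      rank-x : toℕ (rank x) ≡ n
      rank-x = trans (cong toℕ (proj₂ (injective⇒preimage rank-injective (fromℕ< n<k+k)))) (toℕ-fromℕ< n<k+k)

      found : ∀ s → splitAt k x ≡ s → ∃ λ w → A w ≡ n ⊎ Q w ≡ n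
      found (inj₁ w) eq = w , inj₁ (trans (cong (toℕ ∘ rank) (splitAt⁻¹-↑ˡ eq)) rank-x)
      found (inj₂ w) eq = w , inj₂ (trans (cong (toℕ ∘ rank) (splitAt⁻¹-↑ʳ eq)) rank-x)

-- Permutations realised from points with position keys.

module Realisation {k r} (κ : Fin k × Fin r → ℕ) (κ-injective : Injective _≡_ _≡_ κ) where

  infix 4 _<ᵛ_

  data _<ᵛ_ : Fin k × Fin r → Fin k × Fin r → Set where
    across : ∀ {v w c d} → v < w → (v , c) <ᵛ (w , d)
    within : ∀ {v c d} → c < d → (v , c) <ᵛ (v , d)

  <ᵛ-irrefl : ∀ {x} → ¬ x <ᵛ x
  <ᵛ-irrefl (across lt) = ℕ.<-irrefl refl lt
  <ᵛ-irrefl (within lt) = ℕ.<-irrefl refl lt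

  <ᵛ-asym : ∀ {x y} → x <ᵛ y → ¬ y <ᵛ x
  <ᵛ-asym (across lt) (across gt) = ℕ.<-asym lt gt
  <ᵛ-asym (across lt) (within _)  = ℕ.<-irrefl refl lt
  <ᵛ-asym (within _)  (across gt) = ℕ.<-irrefl refl gt
  <ᵛ-asym (within lt) (within gt) = ℕ.<-asym lt gt

  <ᵛ-connex : ∀ x y → x <ᵛ y ⊎ x ≡ y ⊎ y <ᵛ x
  <ᵛ-connex (v , c) (w , d) with <-cmp v w
  ... | tri< lt _ _ = inj₁ (across lt)
  ... | tri> _ _ gt = inj₂ (inj₂ (across gt))
  ... | tri≈ _ refl _ with <-cmp c d
  ... | tri< lt _ _ = inj₁ (within lt)
  ... | tri≈ _ refl _ = inj₂ (inj₁ refl)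
  ... | tri> _ _ gt = inj₂ (inj₂ (within gt))

  value : Fin k × Fin r → Fin (k * r)
  value = uncurry combine

  point : Fin (k * r) → Fin k × Fin r
  point = remQuot r

  point-value : ∀ x → point (value x) ≡ x
  point-value (v , c) = remQuot-combine v c

  value-point : ∀ i → value (point i) ≡ i
  value-point = combine-remQuot {k} r

  value-mono : ∀ {x y} → x <ᵛ y → value x < value y
  value-mono {v , c} {w , d} (across v<w) = combine-monoˡ-< c d v<w
  value-mono {v , c} {v , d} (within c<d) = subst₂ ℕ._<_ (sym (toℕ-combine v c)) (sym (toℕ-combine v d))
    (ℕ.+-monoʳ-< (r * toℕ v) c<d)

  value-reflects : ∀ {x y} → value x < value y → x <ᵛ y
  value-reflects {x} {y} lt with <ᵛ-connex x y
  ... | inj₁ x<y = x<y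
  ... | inj₂ (inj₁ refl) = contradiction lt (ℕ.<-irrefl refl)
  ... | inj₂ (inj₂ y<x) = contradiction lt (ℕ.<-asym (value-mono y<x))

  key-injective : Injective _≡_ _≡_ (κ ∘ point)
  key-injective {i} {j} eq = trans (sym (value-point i)) (trans (cong value (κ-injective eq)) (value-point j))

  open Rank (κ ∘ point) using (rank; rank-mono)

  rank-injective : Injective _≡_ _≡_ rank
  rank-injective = strictMono⇒injective key-injective rank-mono

  unrank : Fin (k * r) → Fin (k * r)
  unrank i = proj₁ (injective⇒preimage rank-injective i)

  rank-unrank : ∀ i → rank (unrank i) ≡ i
  rank-unrank i = proj₂ (injective⇒preimage rank-injective i)

  -- `rank` sends a value to its position, so the permutation as a map from positions to values is
  -- its inverse `unrank`.
  realised : Perm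
  realised = perm (k * r) unrank λ {i} {j} eq →
    trans (sym (rank-unrank i)) (trans (cong rank eq) (rank-unrank j))

  at : Fin (k * r) → Fin k × Fin r
  at i = point (unrank i)

  place : Fin k × Fin r → Fin (k * r)
  place x = rank (value x)

  unrank-place : ∀ x → unrank (place x) ≡ value x
  unrank-place x = rank-injective (rank-unrank (place x))

  at-place : ∀ x → at (place x) ≡ x
  at-place x = trans (cong point (unrank-place x)) (point-value x)

  place-at : ∀ i → place (at i) ≡ i
  place-at i = trans (cong rank (value-point (unrank i))) (rank-unrank i)

  place-mono : ∀ {x y} → κ x ℕ.< κ y → place x < place y
  place-mono {x} {y} lt = rank-mono (subst₂ ℕ._<_ (sym (cong κ (point-value x))) (sym (cong κ (point-value y))) lt)

  at-mono : ∀ {i j} → i < j → κ (at i) ℕ.< κ (at j)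
  at-mono {i} {j} lt = strictMono⇒reflects key-injective rank-mono (subst₂ _<_ (sym (rank-unrank i)) (sym (rank-unrank j)) lt)

  at-value-mono : ∀ {i j} → fun realised i < fun realised j → at i <ᵛ at j
  at-value-mono {i} {j} lt = value-reflects (subst₂ _<_ (sym (value-point (unrank i))) (sym (value-point (unrank j))) lt)

  at-value-reflects : ∀ {i j} → at i <ᵛ at j → fun realised i < fun realised j
  at-value-reflects {i} {j} lt = subst₂ _<_ (value-point (unrank i)) (value-point (unrank j)) (value-mono lt)

  PositionConvex ValueConvex : (Fin k × Fin r → Set) → Set
  PositionConvex J = ∀ {x y z} → J x → J z → κ x ℕ.< κ y → κ y ℕ.< κ z → J y
  ValueConvex J = ∀ {x y z} → J x → J z → x <ᵛ y → y <ᵛ z → J y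

  -- Simplicity phrased on points: an interval is convex in both orders, so it can be studied
  -- through `κ` and `<ᵛ` without computing any rank.
  Inseparable : Set₁
  Inseparable = ∀ (J : Fin k × Fin r → Set) → PositionConvex J → ValueConvex J →
    ∀ {x y} → J x → J y → x <ᵛ y → ∀ z → J z

  inseparable⇒simple : Inseparable → Simple realised
  inseparable⇒simple inseparable i j (i≤j , notWhole , a , bounded , covered) with i ≟ j
  ... | yes i≡j = i≡j
  ... | no i≢j = contradiction (whole everything) notWhole
    where
    J : Fin k × Fin r → Set
    J x = i ≤ᶠ place x × place x ≤ᶠ j

    J-position : PositionConvex J
    J-position (i≤x , _) (_ , z≤j) x<y y<z =
      ℕ.≤-trans i≤x (ℕ.<⇒≤ (place-mono x<y)) , ℕ.≤-trans (ℕ.<⇒≤ (place-mono y<z)) z≤j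

    bounds : ∀ {x} → J x → a ℕ.≤ toℕ (value x) × toℕ (value x) ℕ.≤ a + (toℕ j ∸ toℕ i)
    bounds {x} (i≤x , x≤j) = subst (λ u → a ℕ.≤ toℕ u × toℕ u ℕ.≤ a + (toℕ j ∸ toℕ i)) (unrank-place x)
      (bounded (place x) i≤x x≤j)

    J-value : ValueConvex J
    J-value {x} {y} {z} Jx Jz x<y y<z
      with covered (toℕ (value y))
             (ℕ.≤-trans (proj₁ (bounds Jx)) (ℕ.<⇒≤ (value-mono x<y)))
             (ℕ.≤-trans (ℕ.<⇒≤ (value-mono y<z)) (proj₂ (bounds Jz)))
    ... | l , i≤l , l≤j , eq = subst (λ u → i ≤ᶠ u × u ≤ᶠ j)
      (trans (sym (rank-unrank l)) (cong rank (toℕ-injective eq))) (i≤l , l≤j)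

    J-at : ∀ {l} → i ≤ᶠ l → l ≤ᶠ j → J (at l)
    J-at {l} i≤l l≤j = subst (λ u → i ≤ᶠ u × u ≤ᶠ j) (sym (place-at l)) (i≤l , l≤j)

    everything : ∀ z → J z
    everything with <ᵛ-connex (at i) (at j)
    ... | inj₁ lt = inseparable J J-position J-value (J-at ℕ.≤-refl i≤j) (J-at i≤j ℕ.≤-refl) lt
    ... | inj₂ (inj₁ eq) = contradiction (trans (sym (place-at i)) (trans (cong place eq) (place-at j))) i≢j
    ... | inj₂ (inj₂ gt) = inseparable J J-position J-value (J-at i≤j ℕ.≤-refl) (J-at ℕ.≤-refl i≤j) gt

    inside : (∀ z → J z) → ∀ l → i ≤ᶠ l × l ≤ᶠ j
    inside all l = subst (λ u → i ≤ᶠ u × u ≤ᶠ j) (place-at l) (all (at l))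

    whole : (∀ z → J z) → toℕ i ≡ 0 × suc (toℕ j) ≡ k * r
    whole all =
      ℕ.n≤0⇒n≡0 (subst (toℕ i ℕ.≤_) (toℕ-fromℕ< 0<n) (proj₁ (inside all (fromℕ< 0<n)))) ,
      ℕ.≤-antisym (toℕ<n j) (ℕ.≮⇒≥ λ 1+j<n → ℕ.<⇒≱ (ℕ.n<1+n (toℕ j))
        (subst (ℕ._≤ toℕ j) (toℕ-fromℕ< 1+j<n) (proj₂ (inside all (fromℕ< 1+j<n)))))
      where
      0<n : 0 ℕ.< k * r
      0<n = ℕ.≤-trans (s≤s z≤n) (toℕ<n i)

-- Positions of the four points of each block.

pattern floor v = v , 0F
pattern orig v  = v , 1F
pattern link v  = v , 2F
pattern cap v   = v , 3F

module Layout {k} (S : Slots k) where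

  open Slots S

  Q-reflects : ∀ {v w} → Q v ℕ.< Q w → w < v
  Q-reflects {v} {w} lt with <-cmp w v
  ... | tri< w<v _ _ = w<v
  ... | tri≈ _ refl _ = contradiction lt (ℕ.<-irrefl refl)
  ... | tri> _ _ v<w = contradiction lt (ℕ.<-asym (Q-antitone v<w))

  A<Q⇒< : ∀ {v w} → A w ℕ.< Q v → v < w
  A<Q⇒< {v} {w} lt = Q-reflects (ℕ.<-trans (Q<A w) lt)

  -- κ orders the points by position.  The orig or cap of rank t gets 3 (t + 1) + 2, which
  -- leaves room for the floor right before a cap and, one rank earlier, for its link.
  residue slot κ : Fin k × Fin 4 → ℕ
  residue (floor v) = 0
  residue (orig v)  = 2
  residue (link v)  = 1
  residue (cap v)   = 2
  slot (floor v) = suc (Q v)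
  slot (orig v)  = suc (A v)
  slot (link v)  = Q v
  slot (cap v)   = suc (Q v)
  κ x = residue x + slot x * 3

  residue<3 : ∀ x → residue x ℕ.< 3
  residue<3 (floor v) = s≤s z≤n
  residue<3 (orig v)  = s≤s (s≤s (s≤s z≤n))
  residue<3 (link v)  = s≤s (s≤s z≤n)
  residue<3 (cap v)   = s≤s (s≤s (s≤s z≤n))

  κ-injective : Injective _≡_ _≡_ κ
  κ-injective {x} {y} eq = uncurry (same x y) (lex-injective 3 (slot x) (slot y) (residue<3 x) (residue<3 y) eq)
    where
    same : ∀ x y → slot x ≡ slot y → residue x ≡ residue y → x ≡ y
    same (floor v) (floor w) e _ = cong (_, 0F) (Q-injective (ℕ.suc-injective e))
      where
      Q-injective : ∀ {v w} → Q v ≡ Q w → v ≡ w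
      Q-injective {v} {w} eq with <-cmp v w
      ... | tri< v<w _ _ = contradiction (sym eq) (ℕ.<⇒≢ (Q-antitone v<w))
      ... | tri≈ _ v≡w _ = v≡w
      ... | tri> _ _ w<v = contradiction eq (ℕ.<⇒≢ (Q-antitone w<v))
    same (link v) (link w) e _ = cong (λ { (u , _) → u , 2F }) (same (floor v) (floor w) (cong suc e) refl)
    same (cap v) (cap w) e _ = cong (λ { (u , _) → u , 3F }) (same (floor v) (floor w) e refl)
    same (orig v) (orig w) e _ = cong (_, 1F) (A-injective (ℕ.suc-injective e))
    same (floor _) (orig _) _ ()
    same (floor _) (link _) _ ()
    same (floor _) (cap _)  _ ()
    same (link _) (cap _)   _ ()
    same (orig v) (cap w) e _ = contradiction (ℕ.suc-injective e) (A≢Q v w)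
    same (cap v) (orig w) e _ = contradiction (sym (ℕ.suc-injective e)) (A≢Q w v)

  open Realisation κ κ-injective public hiding (key-injective; rank-injective)

  slot<⇒κ< : ∀ x y → slot x ℕ.< slot y → κ x ℕ.< κ y
  slot<⇒κ< x y lt = lex-< 3 lt (residue<3 x)

  κ<⇒slot≤ : ∀ x y → κ x ℕ.< κ y → slot x ℕ.≤ slot y
  κ<⇒slot≤ x y lt = ℕ.≮⇒≥ λ gt → ℕ.<-asym lt (slot<⇒κ< y x gt)

  κ<⇒slot< : ∀ x y → residue y ℕ.≤ residue x → κ x ℕ.< κ y → slot x ℕ.< slot y
  κ<⇒slot< x y res lt = ℕ.≰⇒> λ ge → ℕ.<⇒≱ lt (ℕ.+-mono-≤ res (ℕ.*-monoˡ-≤ 3 ge))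

  Q≤slot : ∀ v c → Q v ℕ.≤ slot (v , c)
  Q≤slot v 0F = ℕ.n≤1+n (Q v)
  Q≤slot v 1F = ℕ.<⇒≤ (ℕ.m<n⇒m<1+n (Q<A v))
  Q≤slot v 2F = ℕ.≤-refl
  Q≤slot v 3F = ℕ.n≤1+n (Q v)

  link<floor : ∀ v → κ (link v) ℕ.< κ (floor v)
  link<floor v = slot<⇒κ< (link v) (floor v) (ℕ.n<1+n (Q v))

  floor<cap : ∀ v → κ (floor v) ℕ.< κ (cap v)
  floor<cap v = ℕ.+-monoˡ-< (suc (Q v) * 3) {0} {2} (s≤s z≤n)

  cap<orig : ∀ v → κ (cap v) ℕ.< κ (orig v)
  cap<orig v = slot<⇒κ< (cap v) (orig v) (s≤s (Q<A v))

  -- Since `Q w < Q v`, the rank `Q v` has a predecessor, and `gapless` finds the orig or cap there.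
  -- Its `κ` has the same multiple of 3 as the link and residue 2 instead of 1. Its block has a
  -- smaller `Q`, hence is higher.
  afterLink : ∀ {v w} → v < w → ∃ λ u → ∃ λ c → v < u × κ (u , c) ≡ suc (κ (link v))
  afterLink {v} {w} v<w with Q v in Qv≡ | Q-antitone v<w
  ... | suc n | _ with gapless v n Qv≡
  ... | u , inj₁ Au≡n = u , 1F , A<Q⇒< (subst₂ ℕ._<_ (sym Au≡n) (sym Qv≡) (ℕ.n<1+n n)) , cong (λ t → 2 + suc t * 3) Au≡n
  ... | u , inj₂ Qu≡n = u , 3F , Q-reflects (subst₂ ℕ._<_ (sym Qu≡n) (sym Qv≡) (ℕ.n<1+n n)) , cong (λ t → 2 + suc t * 3) Qu≡n

  -- Simplicity of the realised permutation.

  module Convex (J : Fin k × Fin 4 → Set) (J-position : PositionConvex J) (J-value : ValueConvex J) where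

    Block : Fin k → Set
    Block v = ∀ c → J (v , c)

    ends⇒block : ∀ {v} → J (floor v) → J (cap v) → Block v
    ends⇒block Jf Jc 0F = Jf
    ends⇒block Jf Jc 1F = J-value Jf Jc (within (s≤s z≤n)) (within (s≤s (s≤s z≤n)))
    ends⇒block Jf Jc 2F = J-value Jf Jc (within (s≤s z≤n)) (within (s≤s (s≤s (s≤s z≤n))))
    ends⇒block Jf Jc 3F = Jc

    floor-orig⇒block : ∀ {v} → J (floor v) → J (orig v) → Block v
    floor-orig⇒block {v} Jf Jo = ends⇒block Jf (J-position Jf Jo (floor<cap v) (cap<orig v))

    orig-link⇒block : ∀ {v} → J (orig v) → J (link v) → Block v
    orig-link⇒block {v} Jo Jl = floor-orig⇒block
      (J-position Jl Jo (link<floor v) (ℕ.<-trans (floor<cap v) (cap<orig v))) Jo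

    link-cap⇒block : ∀ {v} → J (link v) → J (cap v) → Block v
    link-cap⇒block {v} Jl Jc = ends⇒block (J-position Jl Jc (link<floor v) (floor<cap v)) Jc

    -- Read from left to right, a block is link, floor, cap, orig, which is the simple pattern 3142;
    -- any two of its points generate the rest by convexity.
    two⇒block : ∀ {v} {c d : Fin 4} → c < d → J (v , c) → J (v , d) → Block v
    two⇒block {c = 0F} {1F} _ Jf Jo = floor-orig⇒block Jf Jo
    two⇒block {c = 0F} {2F} _ Jf Jl = floor-orig⇒block Jf (J-value Jf Jl (within (s≤s z≤n)) (within (s≤s (s≤s z≤n))))
    two⇒block {c = 0F} {3F} _ Jf Jc = ends⇒block Jf Jc
    two⇒block {c = 1F} {2F} _ Jo Jl = orig-link⇒block Jo Jl
    two⇒block {c = 1F} {3F} _ Jo Jc = orig-link⇒block Jo (J-value Jo Jc (within (s≤s (s≤s z≤n))) (within (s≤s (s≤s (s≤s z≤n)))))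
    two⇒block {c = 2F} {3F} _ Jl Jc = link-cap⇒block Jl Jc
    two⇒block {c = 0F} {0F} ()
    two⇒block {c = 1F} {0F} ()
    two⇒block {c = 1F} {1F} (s≤s ())
    two⇒block {c = 2F} {0F} ()
    two⇒block {c = 2F} {1F} (s≤s ())
    two⇒block {c = 2F} {2F} (s≤s (s≤s ()))
    two⇒block {c = 3F} {0F} ()
    two⇒block {c = 3F} {1F} (s≤s ())
    two⇒block {c = 3F} {2F} (s≤s (s≤s ()))
    two⇒block {c = 3F} {3F} (s≤s (s≤s (s≤s ())))

    -- From left to right the order is `floor w`, `cap w`, `floor v`, `cap v`, so the two given
    -- points enclose the missing ends of both blocks.
    cap-floor⇒blocks : ∀ {v w} → v < w → J (cap v) → J (floor w) → Block v × Block w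
    cap-floor⇒blocks {v} {w} v<w Jc Jf =
      ends⇒block (J-position Jf Jc
        (slot<⇒κ< (floor w) (floor v) (s≤s (Q-antitone v<w))) (floor<cap v)) Jc ,
      ends⇒block Jf (J-position Jf Jc
        (floor<cap w) (slot<⇒κ< (cap w) (cap v) (s≤s (Q-antitone v<w))))

    -- For points in different blocks, the cap of the lower block lies between them in value, unless
    -- it is the lower point itself; in that case the floor of the higher block is forced in.
    someBlock : ∀ {x y} → J x → J y → x <ᵛ y → ∃ Block
    someBlock {v , c} Jx Jy (within c<d) = v , two⇒block c<d Jx Jy
    someBlock {v , 3F} {w , 0F} Jx Jy (across v<w) = v , proj₁ (cap-floor⇒blocks v<w Jx Jy)
    someBlock {v , 3F} {w , suc d} Jx Jy (across v<w) =
      v , proj₁ (cap-floor⇒blocks v<w Jx (J-value Jx Jy (across v<w) (within (s≤s z≤n))))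
    someBlock {v , 0F} Jx Jy (across v<w) = v , two⇒block {d = 3F} (s≤s z≤n) Jx (J-value Jx Jy (within (s≤s z≤n)) (across v<w))
    someBlock {v , 1F} Jx Jy (across v<w) = v , two⇒block {d = 3F} (s≤s (s≤s z≤n)) Jx (J-value Jx Jy (within (s≤s (s≤s z≤n))) (across v<w))
    someBlock {v , 2F} Jx Jy (across v<w) = v , two⇒block {d = 3F} (s≤s (s≤s (s≤s z≤n))) Jx (J-value Jx Jy (within (s≤s (s≤s (s≤s z≤n)))) (across v<w))

    -- The point directly to the right of a link lies in a higher block; it ties each block to the next one up.
    nextBlock : ∀ {v w} → v < w → (∀ u → v < u → w ≤ᶠ u) → Block v → Block w
    nextBlock {v} {w} v<w next Bv with afterLink v<w
    ... | u , c , v<u , κ≡ = proj₂ (cap-floor⇒blocks v<w (Bv 3F) Jw)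
      where
      Ju : J (u , c)
      -- `κ (floor v)` is `κ (link v) + 2`, so the point found lies strictly between link and floor.
      Ju = J-position (Bv 2F) (Bv 0F) (ℕ.≤-reflexive (sym κ≡)) (ℕ.≤-reflexive (cong suc κ≡))

      Jw : J (floor w)
      Jw with ℕ.m≤n⇒m<n∨m≡n (next u v<u)
      ... | inj₁ w<u = J-value (Bv 3F) Ju (across v<w) (across w<u)
      ... | inj₂ w≡u with toℕ-injective w≡u
      ... | refl = first c Ju
        where
        first : ∀ d → J (w , d) → J (floor w)
        first 0F Jd = Jd
        first (suc d) Jd = J-value (Bv 3F) Jd (across v<w) (within (s≤s z≤n))

    blocksUpTo : ∀ d {v w} → toℕ w ≡ d + toℕ v → Block v → Block w
    blocksUpTo zero eq Bv = subst Block (sym (toℕ-injective eq)) Bv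
    blocksUpTo (suc d) {v} {w} eq Bv =
      nextBlock (ℕ.≤-reflexive (sym w≡)) (λ u lt → subst (ℕ._≤ toℕ u) (sym w≡) lt) (blocksUpTo d (toℕ-fromℕ< d+v<k) Bv)
      where
      d+v<k : d + toℕ v ℕ.< k
      d+v<k = ℕ.<-trans (ℕ.n<1+n _) (subst (ℕ._< k) eq (toℕ<n w))

      w≡ : toℕ w ≡ suc (toℕ (fromℕ< d+v<k))
      w≡ = trans eq (cong suc (sym (toℕ-fromℕ< d+v<k)))

    BlocksFrom : Fin k → Set
    BlocksFrom v = ∀ u → v ≤ᶠ u → Block u

    block⇒blocksFrom : ∀ {v} → Block v → BlocksFrom v
    block⇒blocksFrom Bv u v≤u = blocksUpTo _ (sym (ℕ.m∸n+n≡m v≤u)) Bv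

    -- The point after `link v` lies in some higher block, not necessarily `w`, so all blocks from
    -- `w` up are assumed. That point and `floor w` enclose `link v` in position; then `link v` and
    -- `floor w` enclose `cap v` in value.
    prevBlock : ∀ {v w} → v < w → BlocksFrom w → (∀ u → v < u → w ≤ᶠ u) → Block v
    prevBlock {v} {w} v<w above next with afterLink v<w
    ... | u , c , v<u , κ≡ = proj₁ (cap-floor⇒blocks v<w Jcap (above w ℕ.≤-refl 0F))
      where
      Jlink : J (link v)
      Jlink = J-position (above w ℕ.≤-refl 0F) (above u (next u v<u) c)
        (s≤s (ℕ.*-monoˡ-≤ 3 (Q-antitone v<w))) (ℕ.≤-reflexive (sym κ≡))

      Jcap : J (cap v)
      Jcap = J-value Jlink (above w ℕ.≤-refl 0F) (within (s≤s (s≤s (s≤s z≤n)))) (across v<w)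

    blocksDownTo : ∀ d {v w} → toℕ w ≡ d + toℕ v → BlocksFrom w → Block v
    blocksDownTo zero eq above = above _ (ℕ.≤-reflexive eq)
    blocksDownTo (suc d) {v} {w} eq above = blocksDownTo d (toℕ-fromℕ< d+v<k)
      (block⇒blocksFrom (prevBlock {fromℕ< d+v<k} (ℕ.≤-reflexive (sym w≡)) above λ u lt → subst (ℕ._≤ toℕ u) (sym w≡) lt))
      where
      d+v<k : d + toℕ v ℕ.< k
      d+v<k = ℕ.<-trans (ℕ.n<1+n _) (subst (ℕ._< k) eq (toℕ<n w))

      w≡ : toℕ w ≡ suc (toℕ (fromℕ< d+v<k))
      w≡ = trans eq (cong suc (sym (toℕ-fromℕ< d+v<k)))

    block⇒allBlocks : ∀ {v} → Block v → ∀ w → Block w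
    block⇒allBlocks {v} Bv w with ℕ.≤-total (toℕ v) (toℕ w)
    ... | inj₁ v≤w = block⇒blocksFrom Bv w v≤w
    ... | inj₂ w≤v = blocksDownTo _ (sym (ℕ.m∸n+n≡m w≤v)) (block⇒blocksFrom Bv)

  realised-simple : Simple realised
  realised-simple = inseparable⇒simple λ J J-position J-value Jx Jy x<y (v , c) →
    Convex.block⇒allBlocks J J-position J-value (proj₂ (Convex.someBlock J J-position J-value Jx Jy x<y)) v c

  -- Avoidance of π.

  data Upper : Fin k × Fin 4 → Set where
    isOrig : ∀ v → Upper (orig v)
    isCap  : ∀ v → Upper (cap v)

  Upper-residue : ∀ {x} → Upper x → residue x ≡ 2
  Upper-residue (isOrig v) = refl
  Upper-residue (isCap v)  = refl

  residue≤2 : ∀ x → residue x ℕ.≤ 2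
  residue≤2 x = ℕ.≤-pred (residue<3 x)

  -- Origs and caps carry the largest residue, so no point to their right shares their slot. This
  -- allows occurrences to be refuted by counting slots.
  κ<-Upper⇒slot< : ∀ {x} y → Upper x → κ x ℕ.< κ y → slot x ℕ.< slot y
  κ<-Upper⇒slot< {x} y U = κ<⇒slot< x y (subst (residue y ℕ.≤_) (sym (Upper-residue U)) (residue≤2 y))

  Q<slot-below : ∀ {v w} c → w < v → Q v ℕ.< slot (w , c)
  Q<slot-below {w = w} c w<v = ℕ.<-≤-trans (Q-antitone w<v) (Q≤slot w c)

  -- Points of lower blocks have slots above `Q v`, too far right to precede `floor v` or `link v`;
  -- inside the block, floor and orig stand right of the link.
  nonMinimal⇒Upper : ∀ {x y} → κ x ℕ.< κ y → x <ᵛ y → Upper y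
  nonMinimal⇒Upper {y = orig v} _ _ = isOrig v
  nonMinimal⇒Upper {y = cap v} _ _ = isCap v
  nonMinimal⇒Upper {w , c} {floor v} κ< (across w<v) = contradiction (κ<⇒slot< (w , c) (floor v) z≤n κ<) (ℕ.≤⇒≯ (Q<slot-below c w<v))
  nonMinimal⇒Upper {w , c} {link v} κ< (across w<v) = contradiction (κ<⇒slot≤ (w , c) (link v) κ<) (ℕ.<⇒≱ (Q<slot-below c w<v))
  nonMinimal⇒Upper {floor v} {link v} κ< (within _) = contradiction κ< (ℕ.<-asym (link<floor v))
  nonMinimal⇒Upper {orig v} {link v} κ< (within _) = contradiction κ< (ℕ.<-asym (ℕ.<-trans (link<floor v) (ℕ.<-trans (floor<cap v) (cap<orig v))))
  nonMinimal⇒Upper {link v} {link v} κ< (within _) = contradiction κ< (ℕ.<-irrefl refl)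
  nonMinimal⇒Upper {cap v} {link v} κ< (within (s≤s (s≤s ())))

  data LowerLeftOfCap (v : Fin k) : Fin k × Fin 4 → Set where
    isFloor : LowerLeftOfCap v (floor v)
    isLink  : LowerLeftOfCap v (link v)
    isNextLink : ∀ {w} → w < v → Q w ≡ suc (Q v) → LowerLeftOfCap v (link w)

  -- In a lower block `w` all slots are at least `Q w`, hence at least the slot `suc (Q v)` of the
  -- cap. Only a link can attain equality.
  lowerLeftOfCap : ∀ {x v} → κ x ℕ.< κ (cap v) → x <ᵛ cap v → LowerLeftOfCap v x
  lowerLeftOfCap {floor w} {v} κ< (across w<v) =
    contradiction (κ<⇒slot≤ (floor w) (cap v) κ<) (ℕ.<⇒≱ (s≤s (Q-antitone w<v)))
  lowerLeftOfCap {orig w} {v} κ< (across w<v) =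
    contradiction (κ<⇒slot≤ (orig w) (cap v) κ<) (ℕ.<⇒≱ (s≤s (ℕ.<-trans (Q-antitone w<v) (Q<A w))))
  lowerLeftOfCap {link w} {v} κ< (across w<v) =
    isNextLink w<v (ℕ.≤-antisym (κ<⇒slot≤ (link w) (cap v) κ<) (Q-antitone w<v))
  lowerLeftOfCap {cap w} {v} κ< (across w<v) =
    contradiction (κ<⇒slot≤ (cap w) (cap v) κ<) (ℕ.<⇒≱ (s≤s (Q-antitone w<v)))
  lowerLeftOfCap {floor v} κ< (within _) = isFloor
  lowerLeftOfCap {orig v} κ< (within _) = contradiction κ< (ℕ.<-asym (cap<orig v))
  lowerLeftOfCap {link v} κ< (within _) = isLink
  lowerLeftOfCap {cap v} κ< (within lt) = contradiction lt (ℕ.<-irrefl refl)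

  -- The only orig or cap of block `v` below `cap v` is `orig v`, so the lower of two such points
  -- has left the block.
  below-below-cap : ∀ {x y v} → Upper x → Upper y → x <ᵛ y → y <ᵛ cap v → proj₁ x < v
  below-below-cap Ux Uy (across u<w) (across w<v) = ℕ.<-trans u<w w<v
  below-below-cap Ux Uy (within _)   (across w<v) = w<v
  below-below-cap Ux Uy (across u<w) (within _)   = u<w
  below-below-cap Ux (isCap v) _ (within lt) = contradiction lt (ℕ.<-irrefl refl)
  below-below-cap (isOrig v) (isOrig v) (within lt) (within _) = contradiction lt (ℕ.<-irrefl refl)
  below-below-cap (isCap v) (isOrig v) (within (s≤s ())) (within _)

  orig-reflects : ∀ {v w} → orig v <ᵛ orig w → v < w
  orig-reflects (across lt) = lt
  orig-reflects (within lt) = contradiction lt (ℕ.<-irrefl refl)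

  -- An occurrence of `1 ⊕ ρ` among the points: `x` plays the 1 and `R i` plays entry `i` of ρ,
  -- whose values are given by `f`.
  record Occurrence {m} (f : Fin (suc m) → Fin (suc m)) : Set where
    field
      x : Fin k × Fin 4
      R : Fin (suc m) → Fin k × Fin 4
      κ-first : ∀ i → κ x ℕ.< κ (R i)
      κ-mono  : ∀ {i j} → i < j → κ (R i) ℕ.< κ (R j)
      ᵛ-first : ∀ i → x <ᵛ R i
      ᵛ-mono  : ∀ {i j} → f i < f j → R i <ᵛ R j

    upper : ∀ i → Upper (R i)
    upper i = nonMinimal⇒Upper (κ-first i) (ᵛ-first i)

    slot-mono : ∀ {i j} → i < j → slot (R i) ℕ.< slot (R j)
    slot-mono {i} {j} i<j = κ<-Upper⇒slot< (R j) (upper i) (κ-mono i<j)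

    slot-first : ∀ i → slot x ℕ.≤ slot (R i)
    slot-first i = κ<⇒slot≤ x (R i) (κ-first i)

  -- In π, index `zero` is z and the last index is 2; `r` lies strictly between them both in
  -- position and in value.
  module Avoidance {m} {f : Fin (suc m) → Fin (suc m)} (occ : Occurrence f)
    (f-injective : Injective _≡_ _≡_ f) (f-last : f (fromℕ m) ≡ zero)
    {r} (0<r : zero {m} < r) (r<last : r < fromℕ m) (fr<f0 : f r < f zero) where

    open Occurrence occ

    last : Fin (suc m)
    last = fromℕ m

    last-lowest : ∀ i → i ≡ last ⊎ f last < f i
    last-lowest i with f i in fi≡
    ... | zero = inj₁ (f-injective (trans fi≡ (sym f-last)))
    ... | suc _ = inj₂ (subst (λ u → u < suc _) (sym f-last) (s≤s z≤n))

    flast<fr : f last < f r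
    flast<fr with last-lowest r
    ... | inj₁ refl = contradiction r<last (ℕ.<-irrefl refl)
    ... | inj₂ lt = lt

    -- `link w` and `cap w` are one slot apart, but `R zero`, `R r` and `R last` need three
    -- increasing slots in that range.
    link-cap-impossible : ∀ {w} → x ≡ link w → R last ≢ cap w
    link-cap-impossible {w} x≡ last≡ = ℕ.<-irrefl refl (begin-strict
      Q w           ≡⟨ cong slot x≡ ⟨
      slot x        ≤⟨ slot-first zero ⟩
      slot (R zero) <⟨ slot-mono 0<r ⟩
      slot (R r)    ≤⟨ ℕ.≤-pred (ℕ.≤-trans (slot-mono r<last) (ℕ.≤-reflexive (cong slot last≡))) ⟩
      Q w           ∎)
      where open ℕ.≤-Reasoning

    -- If `x` already has at least the slot of the cap, then so does `R zero`, and slots strictly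
    -- increase along `R`.
    first-is-cap : ∀ {i v} → R i ≡ cap v → suc (Q v) ℕ.≤ slot x → R zero ≡ cap v
    first-is-cap {zero} Ri≡ _ = Ri≡
    first-is-cap {suc i} {v} Ri≡ slot≥ = contradiction
      (ℕ.≤-trans (slot-mono {zero} {suc i} (s≤s z≤n)) (ℕ.≤-reflexive (cong slot Ri≡)))
      (ℕ.≤⇒≯ (ℕ.≤-trans slot≥ (slot-first zero)))

    last-below : ∀ {v} → R zero ≡ cap v → proj₁ (R last) < v
    last-below {v} R0≡ = below-below-cap (upper last) (upper r) (ᵛ-mono flast<fr) (subst (R r <ᵛ_) R0≡ (ᵛ-mono fr<f0))

    no-cap : ∀ i v → R i ≢ cap v
    no-cap i v Ri≡ = refute refl (lowerLeftOfCap (subst (λ z → κ x ℕ.< κ z) Ri≡ (κ-first i)) (subst (x <ᵛ_) Ri≡ (ᵛ-first i)))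
      where
      refute : ∀ {y} → x ≡ y → LowerLeftOfCap v y → ⊥
      -- The cap plays z, so the 2 falls into a block below `v`, yet it must lie above `floor v`.
      refute x≡ isFloor = above (R last) (ᵛ-first last)
        (last-below (first-is-cap Ri≡ (ℕ.≤-reflexive (cong slot (sym x≡)))))
        where
        above : ∀ y → x <ᵛ y → ¬ proj₁ y < v
        above (u , c) x<y u<v = <ᵛ-asym x<y (subst ((u , c) <ᵛ_) (sym x≡) (across u<v))
      -- Either the cap plays the 2, with no room for the rest, or the 2 has to fit between `link v`
      -- and `cap v` in value.
      refute x≡ isLink = [ (λ i≡last → link-cap-impossible x≡ (subst (λ j → R j ≡ cap v) i≡last Ri≡)) , notLast ] (last-lowest i)
        where
        between : ∀ {y} → Upper y → link v <ᵛ y → ¬ y <ᵛ cap v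
        between (isOrig _) (across lt) (across gt) = ℕ.<-asym lt gt
        between (isOrig _) (across lt) (within _) = ℕ.<-irrefl refl lt
        between (isOrig _) (within (s≤s ())) _
        between (isCap _) (across lt) (across gt) = ℕ.<-asym lt gt
        between (isCap _) (across lt) (within _) = ℕ.<-irrefl refl lt
        between (isCap _) (within _) gt = <ᵛ-irrefl gt
        notLast : ¬ f last < f i
        notLast lt = between (upper last) (subst (_<ᵛ R last) x≡ (ᵛ-first last)) (subst (R last <ᵛ_) Ri≡ (ᵛ-mono lt))
      -- The cap plays z. As `Q w` exceeds `Q v` by one, no block separates `w` from `v`, so the 2
      -- can only be `cap w`.
      refute x≡ (isNextLink {w} w<v Qw≡) = link-cap-impossible x≡
        (lowest (upper last) (subst (_<ᵛ R last) x≡ (ᵛ-first last))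
          (last-below (first-is-cap Ri≡ (ℕ.≤-reflexive (sym (trans (cong slot x≡) Qw≡))))))
        where
        skips : ∀ {u} → w < u → ¬ u < v
        skips w<u u<v = ℕ.<⇒≱ (ℕ.≤-trans (s≤s (Q-antitone u<v)) (Q-antitone w<u)) (ℕ.≤-reflexive Qw≡)
        lowest : ∀ {y} → Upper y → link w <ᵛ y → proj₁ y < v → y ≡ cap w
        lowest U (across w<u) u<v = contradiction u<v (skips w<u)
        lowest (isOrig _) (within (s≤s ())) _
        lowest (isCap _) (within _) _ = refl

    original : ∀ i → ∃ λ b → R i ≡ orig b
    original i with R i in Ri≡ | upper i
    ... | _ | isOrig b = b , refl
    ... | _ | isCap b = contradiction Ri≡ (no-cap i b)

    b : Fin (suc m) → Fin k
    b i = proj₁ (original i)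

    R≡orig : ∀ i → R i ≡ orig (b i)
    R≡orig i = proj₂ (original i)

    A-b-mono : ∀ {i j} → i < j → A (b i) ℕ.< A (b j)
    A-b-mono {i} {j} i<j = ℕ.≤-pred (subst₂ ℕ._<_ (cong slot (R≡orig i)) (cong slot (R≡orig j)) (slot-mono i<j))

    b-mono : ∀ {i j} → f i < f j → b i < b j
    b-mono {i} {j} lt = orig-reflects (subst₂ _<ᵛ_ (R≡orig i) (R≡orig j) (ᵛ-mono lt))

    -- Any point below `orig v` in value has slot at least `suc (Q v)`. Applied to `x` and the 2,
    -- this puts the cap of block `b last` left of z.
    Q-last<A-first : Q (b last) ℕ.< A (b zero)
    Q-last<A-first = ℕ.≤∧≢⇒<
      (ℕ.≤-pred (ℕ.≤-trans (lowerBound (subst (x <ᵛ_) (R≡orig last) (ᵛ-first last))) (ℕ.≤-trans (slot-first zero) (ℕ.≤-reflexive (cong slot (R≡orig zero))))))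
      (A≢Q (b zero) (b last) ∘ sym)
      where
      lowerBound : ∀ {y v} → y <ᵛ orig v → suc (Q v) ℕ.≤ slot y
      lowerBound {_ , c} (across lt) = Q<slot-below c lt
      lowerBound {floor v} (within _) = ℕ.≤-refl
      lowerBound {orig v} (within lt) = contradiction lt (ℕ.<-irrefl refl)
      lowerBound {link v} (within (s≤s ()))
      lowerBound {cap v} (within (s≤s ()))

    -- The entry of σ that takes over the role of the 1 from `x`.
    p : Fin k
    p = proj₁ (leader (b last))

    A-p≤ : A p ℕ.≤ A (b zero)
    A-p≤ = proj₂ (proj₂ (leader (b last))) (b zero) Q-last<A-first

    p<last : p < b last
    -- Equality would put the 2 no further right than z.
    p<last = ℕ.≤∧≢⇒< (proj₁ (proj₂ (leader (b last)))) λ p≡ →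
      ℕ.<⇒≱ (A-b-mono (ℕ.<-trans 0<r r<last)) (subst (λ u → A u ℕ.≤ A (b zero)) (toℕ-injective p≡) A-p≤)

    p<b : ∀ i → p < b i
    p<b i with last-lowest i
    ... | inj₁ refl = p<last
    ... | inj₂ lt = ℕ.<-trans p<last (b-mono lt)

    A-p<A-b : ∀ i → A p ℕ.< A (b i)
    A-p<A-b zero = ℕ.≤∧≢⇒< A-p≤ λ eq → ℕ.<⇒≢ (p<b zero) (cong toℕ (A-injective eq))
    A-p<A-b (suc i) = ℕ.≤-<-trans A-p≤ (A-b-mono {zero} {suc i} (s≤s z≤n))

-- The simple cover of σ and the conclusion.

module Cover (σ : Perm) where

  open Positions σ
  open Layout slots public

  σ≼realised : σ ≼ realised
  σ≼realised = (λ i → place (orig (fun σ i))) ,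
    (λ i j i<j → place-mono (slot<⇒κ< (orig (fun σ i)) (orig (fun σ j))
      (s≤s (A-mono (subst₂ _<_ (sym (pos-fun i)) (sym (pos-fun j)) i<j))))) ,
    λ i j →
      (λ lt → at-value-reflects (subst₂ _<ᵛ_ (sym (at-place (orig (fun σ i)))) (sym (at-place (orig (fun σ j)))) (across lt))) ,
      λ lt → orig-reflects (subst₂ _<ᵛ_ (at-place (orig (fun σ i))) (at-place (orig (fun σ j))) (at-value-mono lt))

  module _ {m} {f : Fin (suc m) → Fin (suc m)} (f-injective : Injective _≡_ _≡_ f) (f-last : f (fromℕ m) ≡ zero)
    {r} (0<r : zero {m} < r) (r<last : r < fromℕ m) (fr<f0 : f r < f zero) where

    private
      π = 1⊕ perm (suc m) f f-injective

    realised-avoids : π ≼ realised → π ≼ σ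
    realised-avoids (g , g-mono , g-order) = h , h-mono , λ i j → h-order i j , h-reflects i j
      where
      occurrence : Occurrence f
      occurrence = record
        { x = at (g zero)
        ; R = at ∘ g ∘ suc
        ; κ-first = λ i → at-mono (g-mono zero (suc i) (s≤s z≤n))
        ; κ-mono = λ {i} {j} i<j → at-mono (g-mono (suc i) (suc j) (s≤s i<j))
        ; ᵛ-first = λ i → at-value-mono (proj₁ (g-order zero (suc i)) (s≤s z≤n))
        ; ᵛ-mono = λ {i} {j} lt → at-value-mono (proj₁ (g-order (suc i) (suc j)) (s≤s lt))
        }

      open Avoidance occurrence f-injective f-last 0<r r<last fr<f0

      h : Fin (suc (suc m)) → Fin (len σ)
      h zero = pos p
      h (suc i) = pos (b i)

      h-mono : ∀ i j → i < j → h i < h j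
      h-mono zero (suc j) _ = A-reflects (A-p<A-b j)
      h-mono (suc i) (suc j) (s≤s i<j) = A-reflects (A-b-mono i<j)

      value< : ∀ {v w} → v < w → fun σ (pos v) < fun σ (pos w)
      value< = subst₂ _<_ (sym (fun-pos _)) (sym (fun-pos _))

      value> : ∀ {v w} → fun σ (pos v) < fun σ (pos w) → v < w
      value> = subst₂ _<_ (fun-pos _) (fun-pos _)

      h-order : ∀ i j → fun π i < fun π j → fun σ (h i) < fun σ (h j)
      h-order zero (suc j) _ = value< (p<b j)
      h-order (suc i) (suc j) (s≤s lt) = value< (b-mono lt)

      h-reflects : ∀ i j → fun σ (h i) < fun σ (h j) → fun π i < fun π j
      h-reflects zero zero lt = contradiction lt (ℕ.<-irrefl refl)
      h-reflects zero (suc j) _ = s≤s z≤n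
      h-reflects (suc i) zero lt = contradiction (value> lt) (ℕ.<-asym (p<b i))
      -- `R i` and `R j` are origs, so the comparison lifts back to the given occurrence, where
      -- `g-order` reflects it.
      h-reflects (suc i) (suc j) lt = proj₂ (g-order (suc i) (suc j))
        (at-value-reflects (subst₂ _<ᵛ_ (sym (R≡orig i)) (sym (R≡orig j)) (across (value> lt))))

-- The witness is the position of the second smallest value of ρ: it is not first because z is not
-- 3, and not last because the smallest value is there.
middleEntry : ∀ {m} {f : Fin (suc m) → Fin (suc m)} → Injective _≡_ _≡_ f →
  f (fromℕ m) ≡ zero → toℕ (f zero) ≢ 1 → toℕ (f zero) ≢ m →
  ∃ λ r → zero {m} < r × r < fromℕ m × f r < f zero
-- The single entry of a one-entry ρ is also its largest, against `f0≢m`.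
middleEntry {zero} {f} f-injective f-last f0≢1 f0≢m = contradiction (cong toℕ f-last) f0≢m
middleEntry {suc m} {f} f-injective f-last f0≢1 f0≢m with injective⇒preimage f-injective (suc zero)
... | r , fr≡1 = r , ℕ.n≢0⇒n>0 r≢0 , ℕ.≤∧≢⇒< (subst (toℕ r ℕ.≤_) (sym (toℕ-fromℕ (suc m))) (toℕ≤pred[n] r)) r≢last , fr<f0
  where
  r≢0 : toℕ r ≢ 0
  r≢0 eq = f0≢1 (cong toℕ (trans (cong f (sym (toℕ-injective {j = zero} eq))) fr≡1))

  r≢last : toℕ r ≢ toℕ (fromℕ (suc m))
  r≢last eq with trans (sym fr≡1) (trans (cong f (toℕ-injective eq)) f-last)
  ... | ()

  f0≢0 : toℕ (f zero) ≢ 0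
  f0≢0 eq with f-injective (trans (toℕ-injective {j = zero} eq) (sym f-last))
  ... | ()

  fr<f0 : f r < f zero
  fr<f0 = subst (_< f zero) (sym fr≡1) (ℕ.≤∧≢⇒< (ℕ.n≢0⇒n>0 f0≢0) (f0≢1 ∘ sym))

theorem3p8 : (m : ℕ) (f : Fin (suc m) → Fin (suc m)) (inj : Injective _≡_ _≡_ f) →
    f (fromℕ m) ≡ zero → toℕ (f zero) ≢ 1 → toℕ (f zero) ≢ m →
    ¬ Deflatable (Av (1⊕ perm (suc m) f inj))
theorem3p8 m f inj f-last f0≢1 f0≢m with middleEntry inj f-last f0≢1 f0≢m
... | r , 0<r , r<last , fr<f0 = simpleCovers⇒¬Deflatable λ σ avoids →
  Cover.realised σ , Cover.realised-simple σ ,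
  avoids ∘ Cover.realised-avoids σ inj f-last 0<r r<last fr<f0 , Cover.σ≼realised σ
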